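{- Let $n=p_1\cdots p_t$ be a square-free positive integer, where $p_1,\dots,p_t$ are pairwise distinct primes. Let $m_1$ be an integer with $\gcd(m_1,n)=1$. Then $$\left|\{m_2 : 0\le m_2<n,\ \gcd(m_2,n)=1,\ 12s(m_1/n)-12s(m_2/n)\in\mathbb{Z}\}\right| = 2^s,$$ where $s=|\{j : 1\le j\le t,\ m_1\not\equiv \pm 1 \pmod{p_j}\}|$.
   Context: For a positive integer $n$ and an integer $m$ with $\gcd(m,n)=1$, the Dedekind sum is $s(m/n)=\sum_{k=1}^{n} ((k/n))((mk/n))$, where $((x))=x-\lfloor x\rfloor-1/2$ if $x\notin\mathbb{Z}$ and $((x))=0$ if $x\in\mathbb{Z}$ (the sawtooth function). -}

module Defs where

open import Data.Nat as ℕ using (ℕ; zero; suc; NonZero)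
open import Data.Nat.Coprimality using (Coprime; coprime?)
open import Data.Nat.Divisibility using (_∣_; _∣?_)
open import Data.Integer as ℤ using (ℤ; +_; ∣_∣)
open import Data.Integer.DivMod using (_%ℕ_)
open import Data.Rational as ℚ using (ℚ; 0ℚ; ½)
open import Data.List using (List; []; _∷_; filter; length; upTo; map)
open import Data.Product using (_×_)
open import Relation.Nullary using (¬_; Dec; yes; no)
open import Relation.Nullary.Decidable using (_×-dec_; ¬?)
open import Relation.Binary.PropositionalEquality using (_≡_)

-- sawtooth ((a/n)) for the rational a/n (n ≥ 1):
--   0 if a/n ∈ ℤ (i.e. a mod n = 0), else {a/n} - 1/2 = (a mod n)/n - 1/2
sawtooth : (a : ℤ) (n : ℕ) → .{{NonZero n}} → ℚ
sawtooth a n with a %ℕ n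
... | zero  = 0ℚ
... | suc r = ((+ suc r) ℚ./ n) ℚ.- ½

sumFrom1 : ℕ → (ℕ → ℚ) → ℚ
sumFrom1 zero    f = 0ℚ
sumFrom1 (suc K) f = sumFrom1 K f ℚ.+ f (suc K)

dedekind : (m : ℤ) (n : ℕ) → .{{NonZero n}} → ℚ
dedekind m n = sumFrom1 n (λ k → sawtooth (+ k) n ℚ.* sawtooth (m ℤ.* + k) n)

-- a rational (in normal form) is an integer iff its denominator is 1
IsInteger : ℚ → Set
IsInteger q = ℚ.ℚ.denominatorℕ q ≡ 1

isInteger? : (q : ℚ) → Dec (IsInteger q)
isInteger? q = ℚ.ℚ.denominatorℕ q ℕ.≟ 1

twelve : ℚ
twelve = (+ 12) ℚ./ 1

Good : (m₁ : ℤ) (n : ℕ) → .{{NonZero n}} → ℕ → Set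
Good m₁ n m₂ = Coprime m₂ n
  × IsInteger ((twelve ℚ.* dedekind m₁ n) ℚ.- (twelve ℚ.* dedekind (+ m₂) n))

good? : (m₁ : ℤ) (n : ℕ) → .{{_ : NonZero n}} → (m₂ : ℕ) → Dec (Good m₁ n m₂)
good? m₁ n m₂ = coprime? m₂ n ×-dec isInteger? ((twelve ℚ.* dedekind m₁ n) ℚ.- (twelve ℚ.* dedekind (+ m₂) n))

countGood : (m₁ : ℤ) (n : ℕ) → .{{NonZero n}} → ℕ
countGood m₁ n = length (filter (good? m₁ n) (upTo n))

NotPM1 : ℤ → ℕ → Set
NotPM1 m₁ p = ¬ (p ∣ ∣ m₁ ℤ.- ℤ.1ℤ ∣) × ¬ (p ∣ ∣ m₁ ℤ.+ ℤ.1ℤ ∣)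

notPM1? : (m₁ : ℤ) (p : ℕ) → Dec (NotPM1 m₁ p)
notPM1? m₁ p = ¬? (p ∣? _) ×-dec ¬? (p ∣? _)

sCount : ℤ → List ℕ → ℕ
sCount m₁ ps = length (filter (notPM1? m₁) ps)

{-# OPTIONS --safe #-}

-- Let r k = m k mod n and A = Σ k · r k over 0 ≤ k < n.  As r permutes the
-- residues, Σ (r k)² = Σ k² = (n-1)n(2n-1)/6, and n² divides every
-- (m k - r k)²; expanding gives 12 m A ≡ (1 + m²) n (mod n²).  Since
-- 12 s(m₁/n) - 12 s(m₂/n) = 12 (A₁ - A₂) / n², multiplying by the unit m₁ m₂
-- shows that the difference is an integer iff n ∣ (m₁ - m₂)(m₁ m₂ - 1).
-- The number of solutions m₂ is multiplicative in n, and modulo a prime the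
-- solutions are m₁ and m₁⁻¹, which coincide iff m₁ ≡ ±1.

module Submission where

open import Defs
open import Data.Empty using (⊥-elim)
open import Data.Fin using (Fin; toℕ; fromℕ; inject₁; fromℕ<)
open import Data.Fin.Permutation using (permutation)
open import Data.Fin.Properties using (toℕ-fromℕ; toℕ-inject₁; toℕ-fromℕ<; toℕ<n; toℕ-injective)
open import Data.Integer as ℤ using (ℤ; +_; -_; ∣_∣; _+_; _*_; _-_; 0ℤ; 1ℤ)
open import Data.Integer.Coprimality using (coprime-divisor)
open import Data.Integer.DivMod using (_%ℕ_; _/ℕ_; n%ℕd<d; a≡a%ℕn+[a/ℕn]*n)
open import Data.Integer.Divisibility.Signed
import Data.Integer.Properties as ℤ
open import Data.Integer.Tactic.RingSolver using (solve-∀)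
open import Data.List using (List; []; _∷_; _++_; filter; length; upTo)
open import Data.List.Properties using (filter-accept; filter-reject; filter-++; length-++; upTo-∷ʳ)
open import Data.List.Relation.Unary.All as All using (All; []; _∷_)
open import Data.List.Relation.Unary.AllPairs using ([]; _∷_)
open import Data.List.Relation.Unary.Unique.Propositional using (Unique)
open import Data.Nat as ℕ using (ℕ; zero; suc; NonZero; _^_)
open import Data.Nat.Coprimality as Coprimality using (Coprime; coprime-Bézout)
import Data.Nat.Divisibility as ℕ
import Data.Nat.DivMod as ℕ
open import Data.Nat.GCD using (module Bézout)
open import Data.Nat.ListAction using (product)
open import Data.Nat.Primality
  using (Prime; euclidsLemma; prime⇒nonZero; prime⇒irreducible; productOfPrimes≢0)
open import Data.Nat.Primality.Factorisation using (factorisationHasAllPrimeFactors)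
import Data.Nat.Properties as ℕ
open import Data.Product using (∃; _×_; _,_; proj₁; proj₂)
open import Data.Rational as ℚ using (ℚ; ½)
import Data.Rational.Properties as ℚ
import Data.Rational.Solver as ℚ
import Data.Rational.Unnormalised as ℚᵘ
import Data.Rational.Unnormalised.Properties as ℚᵘ
open import Data.Sum using (_⊎_; inj₁; inj₂; [_,_]′)
open import Function using (_∘_)
open import Relation.Binary.PropositionalEquality
open import Relation.Nullary using (¬_; Dec; yes; no)
open import Relation.Nullary.Decidable using (_×-dec_; toSum)
open import Relation.Unary using (Decidable)

open import Algebra.Properties.CommutativeMonoid.Sum ℤ.+-0-commutativeMonoid
  using (sum; sum-init-last; sum-cong-≗; ∑-permute)

-- Integer sums over 0 ≤ k < n.

∑< : ℕ → (ℕ → ℤ) → ℤ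
∑< zero    f = 0ℤ
∑< (suc n) f = ∑< n f + f n

∑-cong : ∀ n {f g} → (∀ k → k ℕ.< n → f k ≡ g k) → ∑< n f ≡ ∑< n g
∑-cong zero    f≗g = refl
∑-cong (suc n) f≗g =
  cong₂ _+_ (∑-cong n λ k k<n → f≗g k (ℕ.m<n⇒m<1+n k<n)) (f≗g n ℕ.≤-refl)

∑-zero : ∀ n → ∑< n (λ _ → 0ℤ) ≡ 0ℤ
∑-zero zero    = refl
∑-zero (suc n) = trans (ℤ.+-identityʳ _) (∑-zero n)

∑-distrib-+ : ∀ n f g → ∑< n (λ k → f k + g k) ≡ ∑< n f + ∑< n g
∑-distrib-+ zero    f g = refl
∑-distrib-+ (suc n) f g =
  trans (cong (_+ (f n + g n)) (∑-distrib-+ n f g))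
        (interchange (∑< n f) (∑< n g) (f n) (g n))
  where
  interchange : ∀ a b c d → (a + b) + (c + d) ≡ (a + c) + (b + d)
  interchange = solve-∀

*-distribˡ-∑ : ∀ n c f → ∑< n (λ k → c * f k) ≡ c * ∑< n f
*-distribˡ-∑ zero    c f = sym (ℤ.*-zeroʳ c)
*-distribˡ-∑ (suc n) c f =
  trans (cong (_+ c * f n) (*-distribˡ-∑ n c f)) (sym (ℤ.*-distribˡ-+ c _ _))

∑-const : ∀ n c → ∑< n (λ _ → c) ≡ + n * c
∑-const zero    c = refl
∑-const (suc n) c = trans (cong (_+ c) (∑-const n c)) (lemma (+ n) c)
  where
  lemma : ∀ x y → x * y + y ≡ (1ℤ + x) * y
  lemma = solve-∀

∑-comm : ∀ m n (f : ℕ → ℕ → ℤ) →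
         ∑< m (λ i → ∑< n (f i)) ≡ ∑< n (λ j → ∑< m (λ i → f i j))
∑-comm zero    n f = sym (∑-zero n)
∑-comm (suc m) n f = trans (cong (_+ ∑< n (f m)) (∑-comm m n f))
  (sym (∑-distrib-+ n (λ j → ∑< m (λ i → f i j)) (f m)))

∑-+-split : ∀ m n f → ∑< (m ℕ.+ n) f ≡ ∑< m f + ∑< n (λ k → f (m ℕ.+ k))
∑-+-split m zero    f rewrite ℕ.+-identityʳ m = sym (ℤ.+-identityʳ _)
∑-+-split m (suc n) f rewrite ℕ.+-suc m n =
  trans (cong (_+ f (m ℕ.+ n)) (∑-+-split m n f)) (ℤ.+-assoc (∑< m f) _ _)

-- Each index below m n is determined by its quotient i and remainder j on division by n. The
-- induction splits off the block of the largest quotient.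
∑-*-split : ∀ m n f → ∑< (m ℕ.* n) f ≡ ∑< m (λ i → ∑< n (λ j → f (i ℕ.* n ℕ.+ j)))
∑-*-split zero    n f = refl
∑-*-split (suc m) n f rewrite ℕ.+-comm n (m ℕ.* n) =
  trans (∑-+-split (m ℕ.* n) n f) (cong (_+ ∑< n λ j → f (m ℕ.* n ℕ.+ j)) (∑-*-split m n f))

∑-squares : ∀ n → + 6 * ∑< n (λ k → + k * + k) ≡ (+ n - 1ℤ) * + n * (+ 2 * + n - 1ℤ)
∑-squares zero    = refl
∑-squares (suc n) = trans (ℤ.*-distribˡ-+ (+ 6) (∑< n λ k → + k * + k) (+ n * + n))
  (trans (cong (_+ + 6 * (+ n * + n)) (∑-squares n)) (lemma (+ n)))
  where
  lemma : ∀ x → (x - 1ℤ) * x * (+ 2 * x - 1ℤ) + + 6 * (x * x)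
              ≡ (1ℤ + x - 1ℤ) * (1ℤ + x) * (+ 2 * (1ℤ + x) - 1ℤ)
  lemma = solve-∀

-- Both sides are the sum of f over 0, ..., n. It moves the range 1, ..., n of the Dedekind sum to
-- the range 0, ..., n - 1 on which residues are permuted.
∑-shift : ∀ n f → ∑< n (f ∘ suc) + f 0 ≡ ∑< n f + f n
∑-shift zero    f = refl
∑-shift (suc n) f = begin
  ∑< n (f ∘ suc) + f (suc n) + f 0     ≡⟨ lemma (∑< n (f ∘ suc)) (f (suc n)) (f 0) ⟩
  (∑< n (f ∘ suc) + f 0) + f (suc n)   ≡⟨ cong (_+ f (suc n)) (∑-shift n f) ⟩
  ∑< n f + f n + f (suc n)             ∎
  where
  open ≡-Reasoning
  lemma : ∀ a b c → a + b + c ≡ a + c + b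
  lemma = solve-∀

-- Bridge to sums over `Fin n`, where `∑-permute` gives invariance under permutations. `∑<` peels
-- off the last term and `sum` the first, hence `sum-init-last`.
∑<≡sum : ∀ n f → ∑< n f ≡ sum {n} (f ∘ toℕ)
∑<≡sum zero    f = refl
∑<≡sum (suc n) f = begin
  ∑< n f + f n                                     ≡⟨ cong (_+ f n) (∑<≡sum n f) ⟩
  sum {n} (f ∘ toℕ) + f n
    ≡⟨ cong₂ _+_ (sum-cong-≗ {n} λ i → cong f (toℕ-inject₁ i)) (cong f (toℕ-fromℕ n)) ⟨
  sum {n} (f ∘ toℕ ∘ inject₁) + f (toℕ (fromℕ n))  ≡⟨ sum-init-last {n} (f ∘ toℕ) ⟨
  sum {suc n} (f ∘ toℕ)                            ∎
  where open ≡-Reasoning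

-- Indicators, and counting as summation.

𝟙 : {P : Set} → Dec P → ℤ
𝟙 (yes _) = 1ℤ
𝟙 (no  _) = 0ℤ

𝟙-true : {P : Set} (P? : Dec P) → P → 𝟙 P? ≡ 1ℤ
𝟙-true (yes _) _ = refl
𝟙-true (no ¬p) p = ⊥-elim (¬p p)

𝟙-false : {P : Set} (P? : Dec P) → ¬ P → 𝟙 P? ≡ 0ℤ
𝟙-false (yes p) ¬p = ⊥-elim (¬p p)
𝟙-false (no  _) _  = refl

𝟙-cong : {P Q : Set} (P? : Dec P) (Q? : Dec Q) → (P → Q) → (Q → P) → 𝟙 P? ≡ 𝟙 Q?
𝟙-cong (yes p) Q? f g = sym (𝟙-true Q? (f p))
𝟙-cong (no ¬p) Q? f g = sym (𝟙-false Q? (¬p ∘ g))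

𝟙-× : {P Q : Set} (P? : Dec P) (Q? : Dec Q) → 𝟙 (P? ×-dec Q?) ≡ 𝟙 P? * 𝟙 Q?
𝟙-× (yes _) (yes _) = refl
𝟙-× (yes _) (no  _) = refl
𝟙-× (no  _) _       = refl

∑-𝟙≟-≥ : ∀ {n a} → n ℕ.≤ a → ∑< n (λ x → 𝟙 (x ℕ.≟ a)) ≡ 0ℤ
∑-𝟙≟-≥ {n} {a} n≤a = trans
  (∑-cong n λ x x<n → 𝟙-false (x ℕ.≟ a) (ℕ.<⇒≢ (ℕ.<-≤-trans x<n n≤a)))
  (∑-zero n)

∑-𝟙≟ : ∀ {n a} → a ℕ.< n → ∑< n (λ x → 𝟙 (x ℕ.≟ a)) ≡ 1ℤ
∑-𝟙≟ {suc n} {a} (ℕ.s≤s a≤n) with n ℕ.≟ a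
... | yes refl = cong (_+ 1ℤ) (∑-𝟙≟-≥ {n} ℕ.≤-refl)
... | no  n≢a  = trans (ℤ.+-identityʳ _) (∑-𝟙≟ (ℕ.≤∧≢⇒< a≤n (n≢a ∘ sym)))

-- Once a count is a sum of indicators, it can be reindexed, exchanged and factored. The list is
-- split at its end to follow the recursion of `∑<`.
length-filter-upTo : ∀ {A : ℕ → Set} (A? : Decidable A) n →
                     + length (filter A? (upTo n)) ≡ ∑< n (λ x → 𝟙 (A? x))
length-filter-upTo A? zero = refl
length-filter-upTo A? (suc n) = begin
  + length (filter A? (upTo (suc n)))
    ≡⟨ cong (λ xs → + length (filter A? xs)) (upTo-∷ʳ n) ⟨
  + length (filter A? (upTo n ++ n ∷ []))
    ≡⟨ cong (+_ ∘ length) (filter-++ A? (upTo n) (n ∷ [])) ⟩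
  + length (filter A? (upTo n) ++ filter A? (n ∷ []))
    ≡⟨ cong +_ (length-++ (filter A? (upTo n))) ⟩
  + length (filter A? (upTo n)) + + length (filter A? (n ∷ []))
    ≡⟨ cong₂ _+_ (length-filter-upTo A? n) (singleton n) ⟩
  ∑< n (λ x → 𝟙 (A? x)) + 𝟙 (A? n) ∎
  where
  open ≡-Reasoning
  singleton : ∀ x → + length (filter A? (x ∷ [])) ≡ 𝟙 (A? x)
  singleton x with A? x
  ... | yes _ = refl
  ... | no  _ = refl

-- Residues modulo n

∣x-y-sym : ∀ {n} x y → n ∣ x - y → n ∣ y - x
∣x-y-sym {n} x y = subst (n ∣_) (lemma x y) ∘ ∣m⇒∣-m
  where
  lemma : ∀ x y → - (x - y) ≡ y - x
  lemma = solve-∀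

∣x-y-trans : ∀ {n} x y z → n ∣ x - y → n ∣ y - z → n ∣ x - z
∣x-y-trans {n} x y z n∣x-y n∣y-z = subst (n ∣_) (lemma x y z) (∣m∣n⇒∣m+n n∣x-y n∣y-z)
  where
  lemma : ∀ x y z → (x - y) + (y - z) ≡ x - z
  lemma = solve-∀

n∣x-x%n : ∀ x n .{{_ : NonZero n}} → + n ∣ x - + (x %ℕ n)
n∣x-x%n x n = divides (x /ℕ n)
  (trans (cong (_- + (x %ℕ n)) (a≡a%ℕn+[a/ℕn]*n x n)) (lemma (+ (x %ℕ n)) (x /ℕ n * + n)))
  where
  lemma : ∀ r s → r + s - r ≡ s
  lemma = solve-∀

-- The larger minus the smaller is a natural number below n, and its only possible multiple of n is
-- 0.
residue-unique : ∀ {n a b} → a ℕ.< n → b ℕ.< n → + n ∣ + a - + b → a ≡ b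
residue-unique {n} {a} {b} a<n b<n n∣a-b =
  [ (λ a≤b → sym (equal a≤b b<n (∣x-y-sym (+ a) (+ b) n∣a-b))) , (λ b≤a → equal b≤a a<n n∣a-b) ]′
  (ℕ.≤-total a b)
  where
  equal : ∀ {a b} → b ℕ.≤ a → a ℕ.< n → + n ∣ + a - + b → a ≡ b
  equal {a} {b} b≤a a<n n∣a-b with a ℕ.∸ b in eq
    | subst (λ x → n ℕ.∣ ∣ x ∣) (trans (ℤ.m-n≡m⊖n a b) (ℤ.⊖-≥ b≤a)) (∣⇒∣ᵤ n∣a-b)
  ... | zero  | _ = ℕ.≤-antisym (ℕ.m∸n≡0⇒m≤n eq) b≤a
  ... | suc d | n∣d = ⊥-elim (ℕ.<⇒≱ a<n
        (ℕ.≤-trans (ℕ.∣⇒≤ n∣d) (ℕ.≤-trans (ℕ.≤-reflexive (sym eq)) (ℕ.m∸n≤m a b))))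

%ℕ-unique : ∀ {n} .{{_ : NonZero n}} x {r} → r ℕ.< n → + n ∣ x - + r → x %ℕ n ≡ r
%ℕ-unique {n} x {r} r<n n∣x-r = residue-unique (n%ℕd<d x n) r<n
  (∣x-y-trans (+ (x %ℕ n)) x (+ r) (∣x-y-sym x _ (n∣x-x%n x n)) n∣x-r)

inverse-modℕ : ∀ m n → Coprime m n → ∃ λ a′ → + n ∣ + m * a′ - 1ℤ
inverse-modℕ m n c with coprime-Bézout c
... | Bézout.+- x y eq = + x , divides (+ y) (begin
    + m * + x - 1ℤ            ≡⟨ cong (_- 1ℤ) (ℤ.*-comm (+ m) (+ x)) ⟩
    + x * + m - 1ℤ            ≡⟨ cong (_- 1ℤ) (ℤ.pos-* x m) ⟨
    + (x ℕ.* m) - 1ℤ          ≡⟨ cong (λ z → + z - 1ℤ) eq ⟨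
    1ℤ + + (y ℕ.* n) - 1ℤ     ≡⟨ cong (λ z → 1ℤ + z - 1ℤ) (ℤ.pos-* y n) ⟩
    1ℤ + + y * + n - 1ℤ       ≡⟨ lemma (+ y * + n) ⟩
    + y * + n                 ∎)
  where
  open ≡-Reasoning
  lemma : ∀ z → 1ℤ + z - 1ℤ ≡ z
  lemma = solve-∀
-- In this sign case 1 + x m = y n, so the inverse of m is -x.
... | Bézout.-+ x y eq = - + x , divides (- + y) (begin
    + m * - + x - 1ℤ             ≡⟨ lemma (+ m) (+ x) ⟩
    - (1ℤ + + x * + m)           ≡⟨ cong (λ z → - (1ℤ + z)) (ℤ.pos-* x m) ⟨
    - (+ (1 ℕ.+ x ℕ.* m))        ≡⟨ cong (λ z → - + z) eq ⟩
    - (+ (y ℕ.* n))              ≡⟨ cong -_ (ℤ.pos-* y n) ⟩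
    - (+ y * + n)                ≡⟨ ℤ.neg-distribˡ-* (+ y) (+ n) ⟩
    - + y * + n                  ∎)
  where
  open ≡-Reasoning
  lemma : ∀ u v → u * - v - 1ℤ ≡ - (1ℤ + v * u)
  lemma = solve-∀

inverse-mod : ∀ a n → Coprime ∣ a ∣ n → ∃ λ a′ → + n ∣ a * a′ - 1ℤ
inverse-mod (+ m)      n c = inverse-modℕ m n c
inverse-mod ℤ.-[1+ m ] n c with inverse-modℕ (suc m) n c
... | a′ , n∣ = - a′ , subst (λ z → + n ∣ z - 1ℤ) (lemma (+ suc m) a′) n∣
  where
  lemma : ∀ x y → x * y ≡ - x * - y
  lemma = solve-∀

-- As a is a unit modulo n, k ↦ a k + b permutes the residues, with inverse j ↦ a′ (j - b). The case
-- b = 0 serves the Dedekind sum, general b the Chinese remainder count.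
∑-affine : ∀ n .{{_ : NonZero n}} a b f → Coprime ∣ a ∣ n →
           ∑< n (λ k → f ((a * + k + b) %ℕ n)) ≡ ∑< n f
∑-affine n a b f c with inverse-mod a n c
... | a′ , n∣aa′-1 = begin
  ∑< n (f ∘ to)             ≡⟨ ∑<≡sum n (f ∘ to) ⟩
  sum {n} (f ∘ to ∘ toℕ)    ≡⟨ sum-cong-≗ {n} (λ i → cong f (toℕ-fromℕ< (n%ℕd<d (a * + toℕ i + b) n))) ⟨
  sum {n} (f ∘ toℕ ∘ toF)   ≡⟨ ∑-permute {n} {n} (f ∘ toℕ) (permutation toF fromF to∘from from∘to) ⟨
  sum {n} (f ∘ toℕ)         ≡⟨ ∑<≡sum n f ⟨
  ∑< n f                    ∎
  where
  open ≡-Reasoning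
  to from : ℕ → ℕ
  to k   = (a * + k + b) %ℕ n
  from k = (a′ * (+ k - b)) %ℕ n
  toF fromF : Fin n → Fin n
  toF i   = fromℕ< (n%ℕd<d (a * + toℕ i + b) n)
  fromF i = fromℕ< (n%ℕd<d (a′ * (+ toℕ i - b)) n)

  to-from : ∀ {j} → j ℕ.< n → to (from j) ≡ j
  to-from {j} j<n = %ℕ-unique (a * + from j + b) j<n (subst (+ n ∣_)
    (lemma a a′ b (+ j) (+ from j))
    (∣m∣n⇒∣m-n (∣n⇒∣m*n (+ j - b) n∣aa′-1) (∣n⇒∣m*n a (n∣x-x%n (a′ * (+ j - b)) n))))
    where
    lemma : ∀ a a′ b j r → (j - b) * (a * a′ - 1ℤ) - a * (a′ * (j - b) - r) ≡ a * r + b - j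
    lemma = solve-∀

  from-to : ∀ {j} → j ℕ.< n → from (to j) ≡ j
  from-to {j} j<n = %ℕ-unique (a′ * (+ to j - b)) j<n (subst (+ n ∣_)
    (lemma a a′ b (+ j) (+ to j))
    (∣m∣n⇒∣m-n (∣n⇒∣m*n (+ j) n∣aa′-1) (∣n⇒∣m*n a′ (n∣x-x%n (a * + j + b) n))))
    where
    lemma : ∀ a a′ b j r → j * (a * a′ - 1ℤ) - a′ * (a * j + b - r) ≡ a′ * (r - b) - j
    lemma = solve-∀

  to∘from : ∀ i → toF (fromF i) ≡ i
  to∘from i = toℕ-injective (trans (toℕ-fromℕ< (n%ℕd<d (a * + toℕ (fromF i) + b) n))
    (trans (cong to (toℕ-fromℕ< (n%ℕd<d (a′ * (+ toℕ i - b)) n))) (to-from (toℕ<n i))))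
  from∘to : ∀ i → fromF (toF i) ≡ i
  from∘to i = toℕ-injective (trans (toℕ-fromℕ< (n%ℕd<d (a′ * (+ toℕ (toF i) - b)) n))
    (trans (cong from (toℕ-fromℕ< (n%ℕd<d (a * + toℕ i + b) n))) (from-to (toℕ<n i))))

%ℕ-cong : ∀ {n} .{{_ : NonZero n}} x y → + n ∣ x - y → x %ℕ n ≡ y %ℕ n
%ℕ-cong {n} x y n∣x-y = %ℕ-unique x (n%ℕd<d y n) (∣x-y-trans x y _ n∣x-y (n∣x-x%n y n))

coprime-* : ∀ {a b n} → Coprime a n → Coprime b n → Coprime (a ℕ.* b) n
coprime-* c c′ (d∣ab , d∣n) = c′ (Coprimality.coprime-divisor
  (λ (e∣d , e∣a) → c (e∣a , ℕ.∣-trans e∣d d∣n)) d∣ab , d∣n)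

∣-cancel-coprime : ∀ {i} j {k} → Coprime ∣ j ∣ ∣ i ∣ → i ∣ j * k → i ∣ k
∣-cancel-coprime {i} j {k} c i∣jk =
  ∣ᵤ⇒∣ (coprime-divisor i j k (Coprimality.sym c) (∣⇒∣ᵤ i∣jk))

coprime-∣ : ∀ {m k n} → k ℕ.∣ n → Coprime m n → Coprime m k
coprime-∣ k∣n c (d∣m , d∣k) = c (d∣m , ℕ.∣-trans d∣k k∣n)

-- Write z = q n; since k is coprime to n and divides q n, it divides q.
∣-product-coprime : ∀ {k n z} .{{_ : NonZero n}} → Coprime k n → + k ∣ z → + n ∣ z → + (k ℕ.* n) ∣ z
∣-product-coprime {k} {n} {z} c k∣z (divides q z≡qn) =
  subst₂ _∣_ (sym (ℤ.pos-* k n)) (sym z≡qn)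
    (*-monoˡ-∣ (+ n) (∣-cancel-coprime (+ n) (Coprimality.sym c)
      (subst (+ k ∣_) (trans z≡qn (ℤ.*-comm q (+ n))) k∣z)))

-- The integers inside ℚ

ι : ℤ → ℚ
ι z = z ℚ./ 1

toℚᵘ-ι : ∀ z → ℚ.toℚᵘ (ι z) ℚᵘ.≃ ℚᵘ.mkℚᵘ z 0
toℚᵘ-ι z = ℚ.toℚᵘ-fromℚᵘ (ℚᵘ.mkℚᵘ z 0)

ι-+ : ∀ x y → ι (x + y) ≡ ι x ℚ.+ ι y
ι-+ x y = ℚ.toℚᵘ-injective (begin
  ℚ.toℚᵘ (ι (x + y))                   ≈⟨ toℚᵘ-ι (x + y) ⟩
  ℚᵘ.mkℚᵘ (x + y) 0                    ≈⟨ ℚᵘ.*≡* (lemma x y) ⟩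
  ℚᵘ.mkℚᵘ x 0 ℚᵘ.+ ℚᵘ.mkℚᵘ y 0         ≈⟨ ℚᵘ.+-cong (toℚᵘ-ι x) (toℚᵘ-ι y) ⟨
  ℚ.toℚᵘ (ι x) ℚᵘ.+ ℚ.toℚᵘ (ι y)       ≈⟨ ℚ.toℚᵘ-homo-+ (ι x) (ι y) ⟨
  ℚ.toℚᵘ (ι x ℚ.+ ι y)                 ∎)
  where
  open ℚᵘ.≃-Reasoning
  lemma : ∀ x y → (x + y) * 1ℤ ≡ (x * 1ℤ + y * 1ℤ) * 1ℤ
  lemma = solve-∀

ι-* : ∀ x y → ι (x * y) ≡ ι x ℚ.* ι y
ι-* x y = ℚ.toℚᵘ-injective (begin
  ℚ.toℚᵘ (ι (x * y))                   ≈⟨ toℚᵘ-ι (x * y) ⟩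
  ℚᵘ.mkℚᵘ x 0 ℚᵘ.* ℚᵘ.mkℚᵘ y 0         ≈⟨ ℚᵘ.*-cong (toℚᵘ-ι x) (toℚᵘ-ι y) ⟨
  ℚ.toℚᵘ (ι x) ℚᵘ.* ℚ.toℚᵘ (ι y)       ≈⟨ ℚ.toℚᵘ-homo-* (ι x) (ι y) ⟨
  ℚ.toℚᵘ (ι x ℚ.* ι y)                 ∎)
  where
  open ℚᵘ.≃-Reasoning

ι-neg : ∀ x → ι (- x) ≡ ℚ.- ι x
ι-neg x = ℚ.toℚᵘ-injective (begin
  ℚ.toℚᵘ (ι (- x))                   ≈⟨ toℚᵘ-ι (- x) ⟩
  ℚᵘ.- ℚᵘ.mkℚᵘ x 0                   ≈⟨ ℚᵘ.-‿cong (toℚᵘ-ι x) ⟨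
  ℚᵘ.- ℚ.toℚᵘ (ι x)                  ≈⟨ ℚ.toℚᵘ-homo‿- (ι x) ⟨
  ℚ.toℚᵘ (ℚ.- ι x)                 ∎)
  where
  open ℚᵘ.≃-Reasoning

ι-- : ∀ x y → ι (x - y) ≡ ι x ℚ.- ι y
ι-- x y = trans (ι-+ x (- y)) (cong (ι x ℚ.+_) (ι-neg y))

-- Exhibits the normal form, so that numerator and denominator can be read off by projection.
ι≡mkℚ : ∀ z → ι z ≡ ℚ.mkℚ z 0 (Coprimality.sym (Coprimality.1-coprimeTo ∣ z ∣))
ι≡mkℚ z = ℚ.↥p/↧p≡p _

ι-injective : ∀ {x y} → ι x ≡ ι y → x ≡ y
ι-injective {x} {y} eq =
  cong ℚ.ℚ.numerator (trans (sym (ι≡mkℚ x)) (trans eq (ι≡mkℚ y)))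

-- A positive factor cancels from ≤; doing so in both directions and using antisymmetry gives
-- equality.
ι-cancelˡ : ∀ d {p q} .{{_ : NonZero d}} → ι (+ d) ℚ.* p ≡ ι (+ d) ℚ.* q → p ≡ q
ι-cancelˡ d {p} {q} eq = ℚ.≤-antisym
  (ℚ.*-cancelˡ-≤-pos (ι (+ d)) (ℚ.≤-reflexive eq))
  (ℚ.*-cancelˡ-≤-pos (ι (+ d)) (ℚ.≤-reflexive (sym eq)))
  where instance _ = ℚ.normalize-pos d 1

IsInteger⇒∣ : ∀ {q d w} → ι d ℚ.* q ≡ ι w → IsInteger q → d ∣ w
-- The second field stores the denominator minus one, so integrality forces it to be 0.
IsInteger⇒∣ {q@(ℚ.mkℚ z 0 _)} {d} {w} eq refl = divides z (ι-injective (begin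
  ι w                ≡⟨ eq ⟨
  ι d ℚ.* q          ≡⟨ cong (ι d ℚ.*_) (ℚ.↥p/↧p≡p q) ⟨
  ι d ℚ.* ι z        ≡⟨ ℚ.*-comm (ι d) (ι z) ⟩
  ι z ℚ.* ι d        ≡⟨ ι-* z d ⟨
  ι (z * d)          ∎))
  where open ≡-Reasoning

∣⇒IsInteger : ∀ {q d w} .{{_ : NonZero d}} → ι (+ d) ℚ.* q ≡ ι w → + d ∣ w → IsInteger q
∣⇒IsInteger {q} {d} {w} eq (divides z w≡z*d) = cong ℚ.ℚ.denominatorℕ (trans q≡ιz (ι≡mkℚ z))
  where
  open ≡-Reasoning
  q≡ιz : q ≡ ι z
  q≡ιz = ι-cancelˡ d (begin
    ι (+ d) ℚ.* q      ≡⟨ eq ⟩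
    ι w                ≡⟨ cong ι w≡z*d ⟩
    ι (z * + d)        ≡⟨ ι-* z (+ d) ⟩
    ι z ℚ.* ι (+ d)    ≡⟨ ℚ.*-comm (ι z) (ι (+ d)) ⟩
    ι (+ d) ℚ.* ι z    ∎)

ι-*-/ : ∀ z n .{{_ : NonZero n}} → ι (+ n) ℚ.* (z ℚ./ n) ≡ ι z
ι-*-/ z n@(suc n-1) = ℚ.toℚᵘ-injective (begin
  ℚ.toℚᵘ (ι (+ n) ℚ.* (z ℚ./ n))              ≈⟨ ℚ.toℚᵘ-homo-* (ι (+ n)) (z ℚ./ n) ⟩
  ℚ.toℚᵘ (ι (+ n)) ℚᵘ.* ℚ.toℚᵘ (z ℚ./ n)      ≈⟨ ℚᵘ.*-cong (toℚᵘ-ι (+ n)) (ℚ.toℚᵘ-fromℚᵘ (ℚᵘ.mkℚᵘ z n-1)) ⟩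
  ℚᵘ.mkℚᵘ (+ n) 0 ℚᵘ.* ℚᵘ.mkℚᵘ z n-1          ≈⟨ ℚᵘ.*≡* lemma ⟩
  ℚᵘ.mkℚᵘ z 0                                 ≈⟨ toℚᵘ-ι z ⟨
  ℚ.toℚᵘ (ι z)                                ∎)
  where
  open ℚᵘ.≃-Reasoning
  lemma : (+ n * z) * 1ℤ ≡ z * + (n ℕ.+ 0)
  lemma rewrite ℕ.+-identityʳ n = trans (ℤ.*-identityʳ _) (ℤ.*-comm (+ n) z)

-- The Dedekind sum modulo ℤ

module _ (n : ℕ) .{{_ : NonZero n}} (m : ℤ) where
  residue : ℕ → ℕ
  residue k = (m * + k) %ℕ n

  residueSum : ℤ
  residueSum = ∑< n λ k → + k * + residue k

  ∑-residue : Coprime ∣ m ∣ n → (f : ℕ → ℤ) → ∑< n (f ∘ residue) ≡ ∑< n f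
  ∑-residue c f = trans
    (∑-cong n λ k _ → cong (λ z → f (z %ℕ n)) (sym (ℤ.+-identityʳ (m * + k))))
    (∑-affine n m 0ℤ f c)

  -- The factor 12 is 2 · 6: the 2 comes from the cross term of (m k - r k)², the 6 clears the
  -- denominator of the sum of squares.
  12m*residueSum : Coprime ∣ m ∣ n →
    + n * + n ∣ + 12 * m * residueSum - + n * (1ℤ + m * m)
  12m*residueSum c = divides q (begin
      + 12 * m * A - + n * (1ℤ + m * m)
        ≡⟨ algebra m A S Q (+ n) expand ⟩
      (1ℤ + m * m) * (+ 6 * S - + n) - + 6 * (+ n * + n * Q)
        ≡⟨ cong (λ z → (1ℤ + m * m) * (z - + n) - + 6 * (+ n * + n * Q)) (∑-squares n) ⟩
      (1ℤ + m * m) * ((+ n - 1ℤ) * + n * (+ 2 * + n - 1ℤ) - + n) - + 6 * (+ n * + n * Q)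
        ≡⟨ final m (+ n) Q ⟩
      q * (+ n * + n) ∎)
    where
    open ≡-Reasoning
    quotient² : ℕ → ℤ
    quotient² k = (m * + k) /ℕ n * ((m * + k) /ℕ n)
    A S Q q : ℤ
    A = residueSum
    S = ∑< n λ k → + k * + k
    Q = ∑< n quotient²
    -- From (n - 1) n (2 n - 1) - n = (2 n - 3) n²; subtracting n is what makes this a multiple of
    -- n².
    q = (1ℤ + m * m) * (+ 2 * + n - + 3) - + 6 * Q

    pointwise : ∀ k → + n * + n * quotient² k + (+ 2 * m) * (+ k * + residue k)
                    ≡ m * m * (+ k * + k) + + residue k * + residue k
    pointwise k = square (+ k) m (+ residue k) ((m * + k) /ℕ n) (+ n) (a≡a%ℕn+[a/ℕn]*n (m * + k) n)
      where
      -- The last product is (q n)² - (m k - r)² in factored form; its first factor vanishes because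
      -- m k = r + q n.
      identity : ∀ k m r q n → n * n * (q * q) + (+ 2 * m) * (k * r) ≡
        m * m * (k * k) + r * r + (r + q * n - m * k) * (q * n + m * k - r)
      identity = solve-∀
      square : ∀ k m r q n → m * k ≡ r + q * n →
               n * n * (q * q) + (+ 2 * m) * (k * r) ≡ m * m * (k * k) + r * r
      square k m r q n eq = trans (identity k m r q n)
        (trans (cong (λ z → m * m * (k * k) + r * r + z * (q * n + m * k - r))
                     (trans (cong (_- m * k) (sym eq)) (ℤ.+-inverseʳ (m * k))))
               (ℤ.+-identityʳ _))

    expand : + n * + n * Q + + 2 * m * A ≡ m * m * S + S
    expand = begin
      + n * + n * Q + + 2 * m * A
        ≡⟨ cong₂ _+_ (*-distribˡ-∑ n (+ n * + n) quotient²)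
                     (*-distribˡ-∑ n (+ 2 * m) (λ k → + k * + residue k)) ⟨
      ∑< n (λ k → + n * + n * quotient² k) + ∑< n (λ k → (+ 2 * m) * (+ k * + residue k))
        ≡⟨ ∑-distrib-+ n _ _ ⟨
      ∑< n (λ k → + n * + n * quotient² k + (+ 2 * m) * (+ k * + residue k))
        ≡⟨ ∑-cong n (λ k _ → pointwise k) ⟩
      ∑< n (λ k → m * m * (+ k * + k) + + residue k * + residue k)
        ≡⟨ ∑-distrib-+ n _ _ ⟩
      ∑< n (λ k → m * m * (+ k * + k)) + ∑< n (λ k → + residue k * + residue k)
        ≡⟨ cong₂ _+_ (*-distribˡ-∑ n (m * m) (λ k → + k * + k)) (∑-residue c (λ k → + k * + k)) ⟩
      m * m * S + S ∎

    algebra : ∀ m A S Q n → n * n * Q + + 2 * m * A ≡ m * m * S + S →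
      + 12 * m * A - n * (1ℤ + m * m) ≡ (1ℤ + m * m) * (+ 6 * S - n) - + 6 * (n * n * Q)
    algebra m A S Q n eq = trans (l₁ m A Q n)
      (trans (cong (λ z → + 6 * z - + 6 * (n * n * Q) - n * (1ℤ + m * m)) eq) (l₂ m S Q n))
      where
      l₁ : ∀ m A Q n → + 12 * m * A - n * (1ℤ + m * m) ≡
        + 6 * (n * n * Q + + 2 * m * A) - + 6 * (n * n * Q) - n * (1ℤ + m * m)
      l₁ = solve-∀
      l₂ : ∀ m S Q n → + 6 * (m * m * S + S) - + 6 * (n * n * Q) - n * (1ℤ + m * m) ≡
        (1ℤ + m * m) * (+ 6 * S - n) - + 6 * (n * n * Q)
      l₂ = solve-∀

    final : ∀ m n Q → (1ℤ + m * m) * ((n - 1ℤ) * n * (+ 2 * n - 1ℤ) - n) - + 6 * (n * n * Q)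
                    ≡ ((1ℤ + m * m) * (+ 2 * n - + 3) - + 6 * Q) * (n * n)
    final = solve-∀

-- The sawtooth at r/n scaled by 2n, for 0 ≤ r < n.
sawtoothNum : ℕ → ℕ → ℤ
sawtoothNum zero    n = 0ℤ
sawtoothNum (suc r) n = + 2 * + suc r - + n

sawtooth-scaled : ∀ a n .{{_ : NonZero n}} →
  ι (+ 2) ℚ.* ι (+ n) ℚ.* sawtooth a n ≡ ι (sawtoothNum (a %ℕ n) n)
sawtooth-scaled a n with a %ℕ n
... | zero  = ℚ.*-zeroʳ (ι (+ 2) ℚ.* ι (+ n))
... | suc r = begin
  ι (+ 2) ℚ.* N ℚ.* (x ℚ.- ½)
    ≡⟨ solve 4 (λ t n x h → t :* n :* (x :+ (:- h)) := t :* (n :* x) :+ (:- (t :* h :* n)))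
         refl (ι (+ 2)) N x ½ ⟩
  ι (+ 2) ℚ.* (N ℚ.* x) ℚ.- (ι (+ 2) ℚ.* ½) ℚ.* N
    -- The closed term `ι (+ 2) ℚ.* ½` evaluates to 1, so `*-identityˡ` applies to its product with
    -- `N`.
    ≡⟨ cong₂ (λ u v → ι (+ 2) ℚ.* u ℚ.- v) (ι-*-/ (+ suc r) n) (ℚ.*-identityˡ N) ⟩
  ι (+ 2) ℚ.* ι (+ suc r) ℚ.- N
    ≡⟨ cong (ℚ._- N) (ι-* (+ 2) (+ suc r)) ⟨
  ι (+ 2 * + suc r) ℚ.- N
    ≡⟨ ι-- (+ 2 * + suc r) (+ n) ⟨
  ι (+ 2 * + suc r - + n) ∎
  where
  open ≡-Reasoning
  open ℚ.+-*-Solver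
  N = ι (+ n)
  x = + suc r ℚ./ n

-- The Dedekind sum in terms of the residue sum.

module _ (n : ℕ) .{{_ : NonZero n}} (m : ℤ) where
  sawtoothProduct : ℕ → ℤ
  sawtoothProduct k = sawtoothNum (+ k %ℕ n) n * sawtoothNum (residue n m k) n

  -- 4 n² is (2 n)², one factor 2 n for each of the two sawtooth values in a term.
  dedekind-scaled : ι (+ (4 ℕ.* (n ℕ.* n))) ℚ.* dedekind m n ≡ ι (∑< n (sawtoothProduct ∘ suc))
  dedekind-scaled = go n
    where
    open ≡-Reasoning
    d = ι (+ (4 ℕ.* (n ℕ.* n)))
    d-square : d ≡ (ι (+ 2) ℚ.* ι (+ n)) ℚ.* (ι (+ 2) ℚ.* ι (+ n))
    d-square = begin
      ι (+ (4 ℕ.* (n ℕ.* n)))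
        ≡⟨ cong ι (trans (ℤ.pos-* 4 (n ℕ.* n)) (cong (+ 4 *_) (ℤ.pos-* n n))) ⟩
      ι (+ 4 * (+ n * + n))               ≡⟨ cong ι (lemma (+ n)) ⟩
      ι ((+ 2 * + n) * (+ 2 * + n))       ≡⟨ ι-* (+ 2 * + n) (+ 2 * + n) ⟩
      ι (+ 2 * + n) ℚ.* ι (+ 2 * + n)     ≡⟨ cong (λ z → z ℚ.* z) (ι-* (+ 2) (+ n)) ⟩
      (ι (+ 2) ℚ.* ι (+ n)) ℚ.* (ι (+ 2) ℚ.* ι (+ n)) ∎
      where
      lemma : ∀ x → + 4 * (x * x) ≡ (+ 2 * x) * (+ 2 * x)
      lemma = solve-∀
    term : ∀ k → d ℚ.* (sawtooth (+ k) n ℚ.* sawtooth (m * + k) n) ≡ ι (sawtoothProduct k)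
    term k = begin
      d ℚ.* (x ℚ.* y)
        ≡⟨ cong (ℚ._* (x ℚ.* y)) d-square ⟩
      c ℚ.* c ℚ.* (x ℚ.* y)
        ≡⟨ solve 3 (λ c x y → c :* c :* (x :* y) := (c :* x) :* (c :* y)) refl c x y ⟩
      (c ℚ.* x) ℚ.* (c ℚ.* y)
        ≡⟨ cong₂ ℚ._*_ (sawtooth-scaled (+ k) n) (sawtooth-scaled (m * + k) n) ⟩
      ι u ℚ.* ι v
        ≡⟨ ι-* u v ⟨
      ι (sawtoothProduct k) ∎
      where
      open ℚ.+-*-Solver
      c = ι (+ 2) ℚ.* ι (+ n)
      x = sawtooth (+ k) n
      y = sawtooth (m * + k) n
      u = sawtoothNum (+ k %ℕ n) n
      v = sawtoothNum (residue n m k) n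
    -- The induction needs an upper bound `K` that varies while the modulus stays n.
    go : ∀ K → d ℚ.* sumFrom1 K (λ k → sawtooth (+ k) n ℚ.* sawtooth (m * + k) n)
             ≡ ι (∑< K (sawtoothProduct ∘ suc))
    go zero    = ℚ.*-zeroʳ d
    go (suc K) = trans (ℚ.*-distribˡ-+ d _ _)
      (trans (cong₂ ℚ._+_ (go K) (term (suc K)))
             (sym (ι-+ (∑< K (sawtoothProduct ∘ suc)) (sawtoothProduct (suc K)))))

module _ (n : ℕ) .{{_ : NonZero n}} (m : ℤ) (c : Coprime ∣ m ∣ n) where

  0%n : + 0 %ℕ n ≡ 0
  0%n = ℕ.m*n%n≡0 0 n

  n%n : + n %ℕ n ≡ 0
  n%n = ℕ.n%n≡0 n

  residue-zero : residue n m 0 ≡ 0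
  residue-zero = trans (cong (_%ℕ n) (ℤ.*-zeroʳ m)) 0%n

  -- Otherwise n divides m (k + 1), hence k + 1 by coprimality, although 0 < k + 1 < n.
  residue-nonZero : ∀ {k} → suc k ℕ.< n → residue n m (suc k) ≢ 0
  residue-nonZero {k} k<n eq = ℕ.<⇒≱ k<n (ℕ.∣⇒≤ (∣⇒∣ᵤ {+ n} {+ suc k}
    (∣-cancel-coprime m c (subst (+ n ∣_) (ℤ.+-identityʳ _)
      (subst (λ r → + n ∣ m * + suc k - + r) eq (n∣x-x%n (m * + suc k) n))))))

  -- For 0 < k < n neither k nor its residue is 0, and the generic sawtooth formula holds for both.
  -- At k = 0 that formula would give n² instead of 0, which the indicator corrects.
  sawtoothProduct-< : ∀ k → k ℕ.< n → sawtoothProduct n m k ≡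
    (+ 2 * + k - + n) * (+ 2 * + residue n m k - + n) + - (+ n * + n) * 𝟙 (k ℕ.≟ 0)
  sawtoothProduct-< zero k<n rewrite 0%n | residue-zero = lemma (+ n)
    where
    lemma : ∀ x → 0ℤ ≡ (0ℤ - x) * (0ℤ - x) + - (x * x) * 1ℤ
    lemma = solve-∀
  sawtoothProduct-< (suc k) k<n with residue n m (suc k) in eq
  ... | zero  = ⊥-elim (residue-nonZero k<n eq)
  ... | suc r rewrite ℕ.m<n⇒m%n≡m k<n = lemma (+ suc k) (+ suc r) (+ n)
    where
    lemma : ∀ k r n → (+ 2 * k - n) * (+ 2 * r - n) ≡
      (+ 2 * k - n) * (+ 2 * r - n) + - (n * n) * 0ℤ
    lemma = solve-∀

  sawtoothProduct-0 : sawtoothProduct n m 0 ≡ 0ℤ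
  sawtoothProduct-0 rewrite 0%n = refl

  sawtoothProduct-n : sawtoothProduct n m n ≡ 0ℤ
  sawtoothProduct-n rewrite n%n = refl

  -- The products at 0 and n vanish, so the range may be shifted. The residues have the same sum as
  -- the k themselves, so the bracket is independent of m and will cancel from differences.
  ∑-sawtoothProduct : ∑< n (sawtoothProduct n m ∘ suc) ≡
    + 4 * residueSum n m + (+ n * (+ n * + n) - + 4 * + n * ∑< n (λ k → + k) - + n * + n)
  ∑-sawtoothProduct = begin
    ∑< n (sp ∘ suc)
      ≡⟨ ℤ.+-identityʳ _ ⟨
    ∑< n (sp ∘ suc) + 0ℤ
      ≡⟨ cong (_+_ (∑< n (sp ∘ suc))) sawtoothProduct-0 ⟨
    ∑< n (sp ∘ suc) + sp 0
      ≡⟨ ∑-shift n sp ⟩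
    ∑< n sp + sp n
      ≡⟨ cong (_+_ (∑< n sp)) sawtoothProduct-n ⟩
    ∑< n sp + 0ℤ
      ≡⟨ ℤ.+-identityʳ _ ⟩
    ∑< n sp
      ≡⟨ ∑-cong n (λ k k<n → trans (sawtoothProduct-< k k<n)
           (expand (+ k) (+ r k) (+ n) (δ k))) ⟩
    ∑< n (λ k → + 4 * (+ k * + r k) + (c₂ₙ * + k + (c₂ₙ * + r k + (n² + - n² * δ k))))
      ≡⟨ split ⟩
    + 4 * A + (c₂ₙ * S + (c₂ₙ * S + (+ n * n² + - n² * 1ℤ)))
      ≡⟨ collect A S (+ n) ⟩
    + 4 * A + (+ n * (+ n * + n) - + 4 * + n * S - + n * + n) ∎
    where
    open ≡-Reasoning
    sp = sawtoothProduct n m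
    r = residue n m
    A = residueSum n m
    S = ∑< n (λ k → + k)
    n² = + n * + n
    c₂ₙ = - (+ 2 * + n)
    δ : ℕ → ℤ
    δ k = 𝟙 (k ℕ.≟ 0)
    -- Nested to the right so that `split` can peel off one summand at a time.
    expand : ∀ k r n e → (+ 2 * k - n) * (+ 2 * r - n) + - (n * n) * e ≡
      + 4 * (k * r) + (- (+ 2 * n) * k + (- (+ 2 * n) * r + (n * n + - (n * n) * e)))
    expand = solve-∀
    collect : ∀ A S n → + 4 * A + (- (+ 2 * n) * S + (- (+ 2 * n) * S + (n * (n * n) + - (n * n) * 1ℤ)))
      ≡ + 4 * A + (n * (n * n) - + 4 * n * S - n * n)
    collect = solve-∀
    0<n : 0 ℕ.< n
    0<n = ℕ.>-nonZero⁻¹ n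
    split : ∑< n (λ k → + 4 * (+ k * + r k) + (c₂ₙ * + k + (c₂ₙ * + r k + (n² + - n² * δ k)))) ≡
      + 4 * A + (c₂ₙ * S + (c₂ₙ * S + (+ n * n² + - n² * 1ℤ)))
    split =
      trans (∑-distrib-+ n (λ k → + 4 * (+ k * + r k)) _)
        (cong₂ _+_ (*-distribˡ-∑ n (+ 4) (λ k → + k * + r k))
      (trans (∑-distrib-+ n (λ k → c₂ₙ * + k) _)
        (cong₂ _+_ (*-distribˡ-∑ n c₂ₙ (λ k → + k))
      (trans (∑-distrib-+ n (λ k → c₂ₙ * + r k) _)
        (cong₂ _+_ (trans (*-distribˡ-∑ n c₂ₙ (λ k → + r k))
                          (cong (c₂ₙ *_) (∑-residue n m c (λ k → + k))))
      (trans (∑-distrib-+ n (λ k → n²) (λ k → - n² * δ k))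
        (cong₂ _+_ (∑-const n n²)
                   (trans (*-distribˡ-∑ n (- n²) δ) (cong (- n² *_) (∑-𝟙≟ 0<n))))))))))

-- Integrality of the difference of two Dedekind sums.

module _ (n : ℕ) .{{_ : NonZero n}} (m₁ m₂ : ℤ) (c₁ : Coprime ∣ m₁ ∣ n) (c₂ : Coprime ∣ m₂ ∣ n) where
  private
    A₁ = residueSum n m₁
    A₂ = residueSum n m₂
    D : ℚ
    D = twelve ℚ.* dedekind m₁ n ℚ.- twelve ℚ.* dedekind m₂ n
    instance
      n²≢0 : NonZero (n ℕ.* n)
      n²≢0 = ℕ.m*n≢0 n n
      4n²≢0 : NonZero (4 ℕ.* (n ℕ.* n))
      4n²≢0 = ℕ.m*n≢0 4 (n ℕ.* n)

  -- The summand `C` common to both sums cancels. The 4 is kept on the right to match 4 n² and drops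
  -- out when divisibility is read off.
  dedekind-difference : ι (+ (4 ℕ.* (n ℕ.* n))) ℚ.* D ≡ ι (+ 4 * (+ 12 * (A₁ - A₂)))
  dedekind-difference = begin
    d ℚ.* D
      ≡⟨ solve 4 (λ d t x y → d :* (t :* x :+ :- (t :* y)) := t :* (d :* x :+ :- (d :* y)))
         refl d twelve (dedekind m₁ n) (dedekind m₂ n) ⟩
    twelve ℚ.* (d ℚ.* dedekind m₁ n ℚ.- d ℚ.* dedekind m₂ n)
      ≡⟨ cong₂ (λ x y → twelve ℚ.* (x ℚ.- y)) (scaled m₁ c₁) (scaled m₂ c₂) ⟩
    ι (+ 12) ℚ.* (ι (+ 4 * A₁ + C) ℚ.- ι (+ 4 * A₂ + C))
      ≡⟨ cong (ι (+ 12) ℚ.*_) (ι-- (+ 4 * A₁ + C) (+ 4 * A₂ + C)) ⟨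
    ι (+ 12) ℚ.* ι (+ 4 * A₁ + C - (+ 4 * A₂ + C))
      ≡⟨ ι-* (+ 12) (+ 4 * A₁ + C - (+ 4 * A₂ + C)) ⟨
    ι (+ 12 * (+ 4 * A₁ + C - (+ 4 * A₂ + C)))
      ≡⟨ cong ι (lemma A₁ A₂ C) ⟩
    ι (+ 4 * (+ 12 * (A₁ - A₂))) ∎
    where
    open ≡-Reasoning
    open ℚ.+-*-Solver
    d = ι (+ (4 ℕ.* (n ℕ.* n)))
    C = + n * (+ n * + n) - + 4 * + n * ∑< n (λ k → + k) - + n * + n
    scaled : ∀ m → Coprime ∣ m ∣ n → d ℚ.* dedekind m n ≡ ι (+ 4 * residueSum n m + C)
    scaled m c = trans (dedekind-scaled n m) (cong ι (∑-sawtoothProduct n m c))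
    lemma : ∀ a b c → + 12 * (+ 4 * a + c - (+ 4 * b + c)) ≡ + 4 * (+ 12 * (a - b))
    lemma = solve-∀

  private
    4n²≡ : + (4 ℕ.* (n ℕ.* n)) ≡ + 4 * (+ n * + n)
    4n²≡ = trans (ℤ.pos-* 4 (n ℕ.* n)) (cong (+ 4 *_) (ℤ.pos-* n n))

    coprime-n² : Coprime ∣ m₁ * m₂ ∣ ∣ + n * + n ∣
    coprime-n² = subst₂ Coprime (sym (ℤ.abs-* m₁ m₂)) (sym (ℤ.abs-* (+ n) (+ n)))
      (Coprimality.sym (coprime-* c′ c′))
      where
      c′ : Coprime n (∣ m₁ ∣ ℕ.* ∣ m₂ ∣)
      c′ = Coprimality.sym (coprime-* c₁ c₂)

    -- Both brackets are multiples of n² by `12m*residueSum`; the weights m₂ and m₁ give `A₁` and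
    -- `A₂` the coefficients ± 12 m₁ m₂.
    error : ℤ
    error = m₂ * (+ 12 * m₁ * A₁ - + n * (1ℤ + m₁ * m₁))
          - m₁ * (+ 12 * m₂ * A₂ - + n * (1ℤ + m₂ * m₂))

    n²∣error : + n * + n ∣ error
    n²∣error = ∣m∣n⇒∣m-n (∣n⇒∣m*n m₂ (12m*residueSum n m₁ c₁))
                         (∣n⇒∣m*n m₁ (12m*residueSum n m₂ c₂))

    -- The quadratic arises from m₂ (1 + m₁²) - m₁ (1 + m₂²) = (m₁ - m₂)(m₁ m₂ - 1).
    identity : ∀ m₁ m₂ A₁ A₂ n →
      m₁ * m₂ * (+ 12 * (A₁ - A₂)) ≡
      n * ((m₁ - m₂) * (m₁ * m₂ - 1ℤ)) +
      (m₂ * (+ 12 * m₁ * A₁ - n * (1ℤ + m₁ * m₁)) - m₁ * (+ 12 * m₂ * A₂ - n * (1ℤ + m₂ * m₂)))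
    identity = solve-∀

  -- Multiplying n² ∣ 12 (A₁ - A₂) by m₁ m₂ and dropping `error` leaves n² ∣ n (m₁ - m₂)(m₁ m₂ - 1),
  -- from which one n cancels.
  IsInteger-difference⇒∣ : IsInteger D → + n ∣ (m₁ - m₂) * (m₁ * m₂ - 1ℤ)
  IsInteger-difference⇒∣ int = *-cancelˡ-∣ (+ n) (∣m+n∣n⇒∣m
    (subst (+ n * + n ∣_) (identity m₁ m₂ A₁ A₂ (+ n)) (∣n⇒∣m*n (m₁ * m₂) n²∣)) n²∣error)
    where
    n²∣ : + n * + n ∣ + 12 * (A₁ - A₂)
    n²∣ = *-cancelˡ-∣ (+ 4)
      (subst (_∣ + 4 * (+ 12 * (A₁ - A₂))) 4n²≡ (IsInteger⇒∣ dedekind-difference int))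

  -- The same identity read backwards; m₁ m₂ is cancelled as a unit modulo n².
  ∣⇒IsInteger-difference : + n ∣ (m₁ - m₂) * (m₁ * m₂ - 1ℤ) → IsInteger D
  ∣⇒IsInteger-difference n∣ = ∣⇒IsInteger dedekind-difference
    (subst (_∣ + 4 * (+ 12 * (A₁ - A₂))) (sym 4n²≡) (*-monoʳ-∣ (+ 4)
      (∣-cancel-coprime (m₁ * m₂) coprime-n²
        (subst (+ n * + n ∣_) (sym (identity m₁ m₂ A₁ A₂ (+ n)))
          (∣m∣n⇒∣m+n (*-monoʳ-∣ (+ n) n∣) n²∣error)))))

-- Counting the solutions

quadratic : ℤ → ℤ → ℤ
quadratic m x = (m - x) * (m * x - 1ℤ)

quadratic-cong : ∀ {n} m x y → n ∣ x - y → n ∣ quadratic m x → n ∣ quadratic m y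
quadratic-cong {n} m x y n∣x-y n∣ = subst (n ∣_) (lemma m x y)
  -- The cofactor is the quotient of `quadratic m y - quadratic m x` by x - y.
  (∣m∣n⇒∣m+n n∣ (∣n⇒∣m*n (m * (x + y) - m * m - 1ℤ) n∣x-y))
  where
  lemma : ∀ m x y → (m - x) * (m * x - 1ℤ) + (m * (x + y) - m * m - 1ℤ) * (x - y) ≡
    (m - y) * (m * y - 1ℤ)
  lemma = solve-∀

-- The quadratic is congruent to -m modulo x, so a common divisor of x and n also divides m. Thus
-- every root is a unit, and roots may be counted among all residues.
quadratic⇒coprime : ∀ {n} m x → Coprime ∣ m ∣ n → + n ∣ quadratic m x → Coprime ∣ x ∣ n
quadratic⇒coprime {n} m x c n∣ {d} (d∣x , d∣n) = c (∣⇒∣ᵤ {+ d} d∣m , d∣n)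
  where
  lemma : ∀ m x → (m * m + 1ℤ - m * x) * x - (m - x) * (m * x - 1ℤ) ≡ m
  lemma = solve-∀
  d∣m : + d ∣ m
  d∣m = subst (+ d ∣_) (lemma m x) (∣m∣n⇒∣m-n
    (∣n⇒∣m*n (m * m + 1ℤ - m * x) (∣ᵤ⇒∣ {+ d} {x} d∣x))
    (∣-trans (∣ᵤ⇒∣ {+ d} {+ n} d∣n) n∣))

isSolution : ℤ → ℕ → ℤ → ℤ
isSolution m n x = 𝟙 (+ n ∣? quadratic m x)

solutions : ℤ → ℕ → ℤ
solutions m n = ∑< n λ x → isSolution m n (+ x)

isSolution-% : ∀ m n .{{_ : NonZero n}} x → isSolution m n x ≡ isSolution m n (+ (x %ℕ n))
isSolution-% m n x = 𝟙-cong (_ ∣? _) (_ ∣? _)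
  (quadratic-cong m x _ (n∣x-x%n x n)) (quadratic-cong m _ x (∣x-y-sym x _ (n∣x-x%n x n)))

isSolution-* : ∀ m k n .{{_ : NonZero n}} → Coprime k n → ∀ x →
               isSolution m (k ℕ.* n) x ≡ isSolution m n x * isSolution m k x
isSolution-* m k n c x = trans
  (𝟙-cong (+ (k ℕ.* n) ∣? quadratic m x) (n∣? ×-dec k∣?)
    (λ kn∣ → ∣-trans (∣ᵤ⇒∣ {+ n} (ℕ.n∣m*n k)) kn∣ , ∣-trans (∣ᵤ⇒∣ {+ k} (ℕ.m∣m*n n)) kn∣)
    (λ (n∣ , k∣) → ∣-product-coprime c k∣ n∣))
  (𝟙-× n∣? k∣?)
  where
  n∣? = + n ∣? quadratic m x
  k∣? = + k ∣? quadratic m x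

-- Write x < k n as i n + j: the second factor only sees j, and for fixed j
-- the map i ↦ i n + j permutes the residues modulo k.
solutions-* : ∀ m k n .{{_ : NonZero k}} .{{_ : NonZero n}} → Coprime k n →
              solutions m (k ℕ.* n) ≡ solutions m k * solutions m n
solutions-* m k n c = begin
  solutions m (k ℕ.* n)
    ≡⟨ ∑-*-split k n (λ x → isSolution m (k ℕ.* n) (+ x)) ⟩
  ∑< k (λ i → ∑< n λ j → isSolution m (k ℕ.* n) (+ (i ℕ.* n ℕ.+ j)))
    ≡⟨ ∑-comm k n (λ i j → isSolution m (k ℕ.* n) (+ (i ℕ.* n ℕ.+ j))) ⟩
  ∑< n (λ j → ∑< k λ i → isSolution m (k ℕ.* n) (+ (i ℕ.* n ℕ.+ j)))
    ≡⟨ ∑-cong n (λ j j<n → ∑-cong k λ i _ → factor j<n i) ⟩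
  ∑< n (λ j → ∑< k λ i → isSolution m n (+ j) * isSolution m k (+ ((+ n * + i + + j) %ℕ k)))
    ≡⟨ ∑-cong n (λ j _ → trans (*-distribˡ-∑ k (isSolution m n (+ j)) _)
         (cong (isSolution m n (+ j) *_)
           (∑-affine k (+ n) (+ j) (λ x → isSolution m k (+ x)) (Coprimality.sym c)))) ⟩
  ∑< n (λ j → isSolution m n (+ j) * solutions m k)
    ≡⟨ ∑-cong n (λ j _ → ℤ.*-comm (isSolution m n (+ j)) (solutions m k)) ⟩
  ∑< n (λ j → solutions m k * isSolution m n (+ j))
    ≡⟨ *-distribˡ-∑ n (solutions m k) _ ⟩
  solutions m k * solutions m n ∎
  where
  open ≡-Reasoning
  factor : ∀ {j} → j ℕ.< n → ∀ i → isSolution m (k ℕ.* n) (+ (i ℕ.* n ℕ.+ j)) ≡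
    isSolution m n (+ j) * isSolution m k (+ ((+ n * + i + + j) %ℕ k))
  factor {j} j<n i = trans (isSolution-* m k n c (+ (i ℕ.* n ℕ.+ j))) (cong₂ _*_
    (trans (isSolution-% m n (+ (i ℕ.* n ℕ.+ j)))
      (cong (λ r → isSolution m n (+ r)) (trans
        (cong (λ x → + x %ℕ n) (ℕ.+-comm (i ℕ.* n) j)) (trans (ℕ.[m+kn]%n≡m%n j i n) (ℕ.m<n⇒m%n≡m j<n)))))
    (trans (isSolution-% m k (+ (i ℕ.* n ℕ.+ j)))
      (cong (λ x → isSolution m k (+ (x %ℕ k)))
        (cong (_+ + j) (trans (ℤ.pos-* i n) (ℤ.*-comm (+ i) (+ n)))))))

-- Roots of the quadratic modulo a prime.

prime-∣-* : ∀ {p} → Prime p → ∀ x y → + p ∣ x * y → (+ p ∣ x) ⊎ (+ p ∣ y)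
prime-∣-* {p} pp x y p∣xy
  with euclidsLemma ∣ x ∣ ∣ y ∣ pp (subst (p ℕ.∣_) (ℤ.abs-* x y) (∣⇒∣ᵤ p∣xy))
... | inj₁ p∣x = inj₁ (∣ᵤ⇒∣ p∣x)
... | inj₂ p∣y = inj₂ (∣ᵤ⇒∣ p∣y)

module _ (m : ℤ) {p : ℕ} (pp : Prime p) (c : Coprime ∣ m ∣ p) where
  private
    instance
      p≢0 : NonZero p
      p≢0 = prime⇒nonZero pp
    m′ : ℤ
    m′ = proj₁ (inverse-mod m p c)
    p∣mm′-1 : + p ∣ m * m′ - 1ℤ
    p∣mm′-1 = proj₂ (inverse-mod m p c)
    a b : ℕ
    a = m %ℕ p
    b = m′ %ℕ p

    root-a : + p ∣ quadratic m (+ a)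
    root-a = ∣m⇒∣m*n (m * + a - 1ℤ) (n∣x-x%n m p)

    root-b : + p ∣ quadratic m (+ b)
    root-b = ∣n⇒∣m*n (m - + b) (subst (+ p ∣_) (lemma m m′ (+ b))
      (∣m∣n⇒∣m-n p∣mm′-1 (∣n⇒∣m*n m (n∣x-x%n m′ p))))
      where
      lemma : ∀ m m′ b → (m * m′ - 1ℤ) - m * (m′ - b) ≡ m * b - 1ℤ
      lemma = solve-∀

    -- A prime divides one of the two factors: the first gives x ≡ m, and the second, multiplied by
    -- m′, gives x ≡ m′.
    root⇒ : ∀ {x} → x ℕ.< p → + p ∣ quadratic m (+ x) → x ≡ a ⊎ x ≡ b
    root⇒ {x} x<p p∣ with prime-∣-* pp (m - + x) (m * + x - 1ℤ) p∣
    ... | inj₁ p∣m-x = inj₁ (sym (%ℕ-unique m x<p p∣m-x))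
    ... | inj₂ p∣mx-1 = inj₂ (sym (%ℕ-unique m′ x<p (subst (+ p ∣_) (lemma m m′ (+ x))
          (∣m∣n⇒∣m-n (∣n⇒∣m*n (+ x) p∣mm′-1) (∣n⇒∣m*n m′ p∣mx-1)))))
      where
      lemma : ∀ m m′ x → x * (m * m′ - 1ℤ) - m′ * (m * x - 1ℤ) ≡ m′ - x
      lemma = solve-∀

    -- If m ≡ m′ then m² ≡ m m′ ≡ 1, so p divides (m - 1)(m + 1).
    a≡b⇒±1 : a ≡ b → (+ p ∣ m - 1ℤ) ⊎ (+ p ∣ m + 1ℤ)
    a≡b⇒±1 a≡b = prime-∣-* pp (m - 1ℤ) (m + 1ℤ) (subst (+ p ∣_) (lemma m m′ (+ a))
      (∣m∣n⇒∣m+n (∣n⇒∣m*n m (∣m∣n⇒∣m-n (n∣x-x%n m p)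
        (subst (λ r → + p ∣ m′ - + r) (sym a≡b) (n∣x-x%n m′ p)))) p∣mm′-1))
      where
      lemma : ∀ m m′ a → m * (m - a - (m′ - a)) + (m * m′ - 1ℤ) ≡ (m - 1ℤ) * (m + 1ℤ)
      lemma = solve-∀

    -- Multiply m² ≡ 1 by m′ to get m ≡ m′.
    ±1⇒a≡b : + p ∣ (m - 1ℤ) * (m + 1ℤ) → a ≡ b
    ±1⇒a≡b p∣ = %ℕ-cong m m′ (subst (+ p ∣_) (lemma m m′)
      (∣m∣n⇒∣m-n (∣n⇒∣m*n m′ p∣) (∣n⇒∣m*n m p∣mm′-1)))
      where
      lemma : ∀ m m′ → m′ * ((m - 1ℤ) * (m + 1ℤ)) - m * (m * m′ - 1ℤ) ≡ m - m′
      lemma = solve-∀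

  -- With a ≢ b, the indicator of the roots is the sum of two point indicators, each of total 1.
  solutions-prime-distinct : NotPM1 m p → solutions m p ≡ + 2
  solutions-prime-distinct (p∤m-1 , p∤m+1) = begin
    solutions m p
      ≡⟨ ∑-cong p pointwise ⟩
    ∑< p (λ x → 𝟙 (x ℕ.≟ a) + 𝟙 (x ℕ.≟ b))
      ≡⟨ ∑-distrib-+ p _ _ ⟩
    ∑< p (λ x → 𝟙 (x ℕ.≟ a)) + ∑< p (λ x → 𝟙 (x ℕ.≟ b))
      ≡⟨ cong₂ _+_ (∑-𝟙≟ (n%ℕd<d m p)) (∑-𝟙≟ (n%ℕd<d m′ p)) ⟩
    + 2 ∎
    where
    open ≡-Reasoning
    a≢b : a ≢ b
    a≢b a≡b = [ p∤m-1 ∘ ∣⇒∣ᵤ , p∤m+1 ∘ ∣⇒∣ᵤ ]′ (a≡b⇒±1 a≡b)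
    pointwise : ∀ x → x ℕ.< p → isSolution m p (+ x) ≡ 𝟙 (x ℕ.≟ a) + 𝟙 (x ℕ.≟ b)
    pointwise x x<p with x ℕ.≟ a | x ℕ.≟ b
    ... | yes refl | yes a≡b  = ⊥-elim (a≢b a≡b)
    ... | yes refl | no  _    = 𝟙-true (_ ∣? _) root-a
    ... | no  _    | yes refl = 𝟙-true (_ ∣? _) root-b
    ... | no  x≢a  | no  x≢b  = 𝟙-false (_ ∣? _) ([ x≢a , x≢b ]′ ∘ root⇒ x<p)

  solutions-prime-double : ¬ NotPM1 m p → solutions m p ≡ 1ℤ
  solutions-prime-double ±1 = trans (∑-cong p pointwise) (∑-𝟙≟ (n%ℕd<d m p))
    where
    p∣m²-1 : + p ∣ (m - 1ℤ) * (m + 1ℤ)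
    p∣m²-1 with + p ∣? (m - 1ℤ) | + p ∣? (m + 1ℤ)
    ... | yes p∣ | _      = ∣m⇒∣m*n (m + 1ℤ) p∣
    ... | no  _  | yes p∣ = ∣n⇒∣m*n (m - 1ℤ) p∣
    ... | no p∤₁ | no p∤₂ = ⊥-elim (±1 (p∤₁ ∘ ∣ᵤ⇒∣ , p∤₂ ∘ ∣ᵤ⇒∣))
    pointwise : ∀ x → x ℕ.< p → isSolution m p (+ x) ≡ 𝟙 (x ℕ.≟ a)
    pointwise x x<p = 𝟙-cong (_ ∣? _) (x ℕ.≟ a)
      (λ p∣ → [ (λ x≡a → x≡a) , (λ x≡b → trans x≡b (sym (±1⇒a≡b p∣m²-1))) ]′ (root⇒ x<p p∣))
      (λ { refl → root-a })

-- Square-free moduli and the final count.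

-- A divisor of p is 1 or p, and if p divided the product it would occur in the list. This is where
-- distinctness of the primes enters.
prime-coprime-product : ∀ {p ps} → Prime p → All Prime ps → All (p ≢_) ps → Coprime p (product ps)
prime-coprime-product pp pps p≢ps (d∣p , d∣Π) with prime⇒irreducible pp d∣p
... | inj₁ d≡1  = d≡1
... | inj₂ refl = ⊥-elim (All.lookup p≢ps (factorisationHasAllPrimeFactors pp d∣Π pps) refl)

solutions-product : ∀ m ps → All Prime ps → Unique ps → Coprime ∣ m ∣ (product ps) →
                    solutions m (product ps) ≡ + (2 ^ sCount m ps)
-- Modulo the empty product 1 the only residue is 0, and it is a root: one solution, matching 2⁰.
solutions-product m [] _ _ _ = cong (_+_ 0ℤ) (𝟙-true (+ 1 ∣? quadratic m (+ 0)) (∣ᵤ⇒∣ (ℕ.1∣ _)))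
solutions-product m (p ∷ ps) (pp ∷ pps) (p≢ps ∷ unique) c = begin
  solutions m (p ℕ.* product ps)
    ≡⟨ solutions-* m p (product ps) (prime-coprime-product pp pps p≢ps) ⟩
  solutions m p * solutions m (product ps)
    ≡⟨ cong (solutions m p *_) (solutions-product m ps pps unique (coprime-∣ (ℕ.n∣m*n p) c)) ⟩
  solutions m p * + (2 ^ sCount m ps)
    ≡⟨ step ⟩
  + (2 ^ sCount m (p ∷ ps)) ∎
  where
  open ≡-Reasoning
  instance
    _ = prime⇒nonZero pp
    _ = productOfPrimes≢0 pps
  c′ : Coprime ∣ m ∣ p
  c′ = coprime-∣ (ℕ.m∣m*n (product ps)) c
  step : solutions m p * + (2 ^ sCount m ps) ≡ + (2 ^ sCount m (p ∷ ps))
  step = [ distinct , double ]′ (toSum (notPM1? m p))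
    where
    distinct : NotPM1 m p → solutions m p * + (2 ^ sCount m ps) ≡ + (2 ^ sCount m (p ∷ ps))
    distinct ≢±1 = trans
      (cong (_* + (2 ^ sCount m ps)) (solutions-prime-distinct m pp c′ ≢±1))
      (trans (sym (ℤ.pos-* 2 (2 ^ sCount m ps)))
        (cong (λ qs → + (2 ^ length qs)) (sym (filter-accept (notPM1? m) {xs = ps} ≢±1))))
    double : ¬ NotPM1 m p → solutions m p * + (2 ^ sCount m ps) ≡ + (2 ^ sCount m (p ∷ ps))
    double ±1 = trans
      (cong (_* + (2 ^ sCount m ps)) (solutions-prime-double m pp c′ ±1))
      (trans (ℤ.*-identityˡ (+ (2 ^ sCount m ps)))
        (cong (λ qs → + (2 ^ length qs)) (sym (filter-reject (notPM1? m) {xs = ps} ±1))))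

theorem3 : (ps : List ℕ) → All Prime ps → Unique ps →
    (n : ℕ) → .{{_ : NonZero n}} → n ≡ product ps →
    (m₁ : ℤ) → Coprime ∣ m₁ ∣ n →
    countGood m₁ n ≡ 2 ^ sCount m₁ ps
theorem3 ps pps unique n n≡Πps m₁ c = ℤ.+-injective (begin
  + countGood m₁ n
    ≡⟨ length-filter-upTo (good? m₁ n) n ⟩
  ∑< n (λ x → 𝟙 (good? m₁ n x))
    -- The indicators agree at every x, coprime to n or not, as each root is coprime to n by
    -- `quadratic⇒coprime`.
    ≡⟨ ∑-cong n (λ x _ → 𝟙-cong (good? m₁ n x) (_ ∣? _) good⇒ good⇐) ⟩
  solutions m₁ n
    -- `solutions` takes no `NonZero` instance, so the modulus is replaced by plain congruence.
    ≡⟨ cong (solutions m₁) n≡Πps ⟩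
  solutions m₁ (product ps)
    ≡⟨ solutions-product m₁ ps pps unique (subst (Coprime ∣ m₁ ∣) n≡Πps c) ⟩
  + (2 ^ sCount m₁ ps) ∎)
  where
  open ≡-Reasoning
  good⇒ : ∀ {x} → Good m₁ n x → + n ∣ quadratic m₁ (+ x)
  good⇒ {x} (c₂ , int) = IsInteger-difference⇒∣ n m₁ (+ x) c c₂ int
  good⇐ : ∀ {x} → + n ∣ quadratic m₁ (+ x) → Good m₁ n x
  good⇐ {x} n∣ = c₂ , ∣⇒IsInteger-difference n m₁ (+ x) c c₂ n∣
    where
    c₂ : Coprime x n
    c₂ = quadratic⇒coprime m₁ (+ x) c n∣
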